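{- Let $n,k,t$ be integers with $n\ge 5$, $0<2t\le k\le 2^{n-1}$ and $2^{ -n}t>\frac{1}{24}+\frac{7}{64}$. Then every $S\subset\{0,1\}^n$ with $|S|=k$ and $\mathrm{Type}(S)=t$ satisfies $\theta(n,S)\ge 2^n f(2^{ -n}k)$; equivalently $\theta(n,k,t)\ge 2^n f(2^{ -n}k)$.
   Context: $Q_n$ is the hypercube graph on $\{0,1\}^n$ (vertices adjacent iff they differ in exactly one coordinate). For $S\subset\{0,1\}^n$, $\theta(n,S)$ is the number of edges of $Q_n$ with exactly one endpoint in $S$. A half plane of $Q_n$ is a set $\{x\in\{0,1\}^n: x_i=a\}$ for some $1\le i\le n$, $a\in\{0,1\}$. $\mathrm{Type}(S)=\min_H |S\cap H|$ over all $2n$ half planes $H$. $\theta(n,k,t)=\min\{\theta(n,S): |S|=k, \mathrm{Type}(S)=t\}$. $f(x)=\frac34-\frac{64}{7}\left(x-\frac12\right)^2$. -}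

module Defs where

open import Data.Bool using (Bool; true; false; not; if_then_else_; _∧_; _xor_)
open import Data.Nat using (ℕ; zero; suc; _+_; _*_; _^_; _⊓_; NonZero)
open import Data.Nat.Properties using (m^n≢0)
open import Data.Fin using (Fin)
open import Data.Vec using (Vec; []; _∷_; lookup; updateAt)
open import Data.List using (List; []; _∷_; map; concatMap; length; filter; foldr; allFin; _++_)
open import Data.Integer using (+_)
open import Data.Rational using (ℚ; _/_) renaming (_+_ to _+ℚ_; _-_ to _-ℚ_; _*_ to _*ℚ_)
open import Relation.Nullary.Decidable using (does)
open import Relation.Binary.PropositionalEquality using (_≡_)
open import Data.Bool.Properties using () renaming (_≟_ to _≟B_)

Subset : ℕ → Set
Subset n = Vec Bool n → Bool

allVertices : (n : ℕ) → List (Vec Bool n)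
allVertices zero = [] ∷ []
allVertices (suc n) = map (false ∷_) (allVertices n) ++ map (true ∷_) (allVertices n)

count : {n : ℕ} → (Vec Bool n → Bool) → ℕ
count {n} P = length (filter (λ x → P x ≟B true) (allVertices n))

card : {n : ℕ} → Subset n → ℕ
card S = count S

flipAt : {n : ℕ} → Fin n → Vec Bool n → Vec Bool n
flipAt i x = updateAt x i not

-- θ(n,S): each edge of Q_n is {x, flipAt i x} with x_i = 0, counted once.
theta : (n : ℕ) → Subset n → ℕ
theta n S = foldr _+_ 0
  (map (λ i → count (λ x → not (lookup x i) ∧ (S x xor S (flipAt i x)))) (allFin n))

halfPlaneCount : {n : ℕ} → Subset n → Fin n → Bool → ℕ
halfPlaneCount S i a = count (λ x → S x ∧ does (lookup x i ≟B a))

-- Type(S) = min over the 2n half planes of |S ∩ H|.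
-- (Initial value |S| is an upper bound of every |S ∩ H|, so for n ≥ 1
-- this is exactly the minimum.)
Type : {n : ℕ} → Subset n → ℕ
Type {n} S = foldr _⊓_ (card S)
  (concatMap (λ i → halfPlaneCount S i false ∷ halfPlaneCount S i true ∷ []) (allFin n))

scaled : ℕ → ℕ → ℚ
scaled n m = (+ m) / (2 ^ n)
  where instance _ : NonZero (2 ^ n)
                 _ = m^n≢0 2 n

f : ℚ → ℚ
f x = (+ 3 / 4) -ℚ (+ 64 / 7) *ℚ ((x -ℚ + 1 / 2) *ℚ (x -ℚ + 1 / 2))

{-# OPTIONS --safe #-}
module Submission where

-- Write N = 2ⁿ, k = |S|, θ = θ(n, S), and let bᵢ be the difference of the sizes of S in
-- the two half planes of direction i.
--
-- If N < 6 |bᵢ| for some i, cut the cube along i: θ is at least the sum of the boundaries of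
-- the two halves of S plus |bᵢ|.  The type hypothesis keeps both densities in the range where
-- an edge-isoperimetric inequality (IsoBound) bounds the normalised boundary of a half below by
-- x + 1/4, with x the density of S in the sparser half, respectively of its complement in the
-- denser half.  Adding up, θ ≥ 3N / 4.
--
-- If 6 |bᵢ| ≤ N for all i, Parseval with levels ≥ 2 weighted by at least 2 gives
-- N θ ≥ 4 k (N − k) − 2 Σ bᵢ², while Σ |bᵢ| ≤ θ gives 6 Σ bᵢ² ≤ N θ.
-- Hence N θ ≥ 3 k (N − k) ≥ N² f(k / N).

open import Defs
open import Data.Sum using (_⊎_; inj₁; inj₂)
open import Relation.Binary.PropositionalEquality using (_≡_; refl; sym; trans; cong; cong₂; subst; subst₂)

-- Integer linear arithmetic for the isoperimetric induction and the two cases of the proof.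

module LinearInequalities where

  open import Data.Integer using (ℤ; +_; _+_; _-_; _*_; _≤_; nonNegative)
  open import Data.Integer.Properties
  open import Data.Integer.Tactic.RingSolver using (solve)
  open import Data.List using ([]; _∷_)

  infixl 6 _⊕_
  _⊕_ : ∀ {a b c d} → a ≤ b → c ≤ d → a + c ≤ b + d
  _⊕_ = +-mono-≤

  infixl 5 _⟫_
  -- Equal slack transfers an inequality. A linear goal is closed by adding hypotheses with `⊕`
  -- until the slack of the sum is, by ring identities, the slack of the goal.
  _⟫_ : ∀ {a b c d} → a ≤ b → d - c ≡ b - a → c ≤ d
  p ⟫ e = 0≤i-j⇒j≤i (≤-trans (i≤j⇒0≤j-i p) (≤-reflexive (sym e)))

  -- With x = k / N this says θ / N ≥ min (3x , x + 1/4 , 1 − x).  The maximum of this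
  -- bound at x and at 1 − x is the third partial sum of the Takagi function.
  IsoBound : ℤ → ℤ → ℤ → Set
  IsoBound N k θ = (+ 12 * k ≤ + 4 * θ) ⊎ (+ 4 * k + N ≤ + 4 * θ) ⊎ (+ 4 * N - + 4 * k ≤ + 4 * θ)

  pattern first h = inj₁ h
  pattern second h = inj₂ (inj₁ h)
  pattern third h = inj₂ (inj₂ h)

  -- An average of two alternatives is at least the smaller one, and the case split finds which one
  -- is smaller. The next two lemmas do the same for the other pairs of alternatives in a cube of
  -- `2M` vertices.
  mean-first-second : ∀ M s Θ → + 8 * s + M ≤ + 4 * Θ → IsoBound (+ 2 * M) s Θ
  mean-first-second M s Θ h = split (≤-total (+ 4 * s) M)
    where
    split : (+ 4 * s) ≤ M ⊎ M ≤ (+ 4 * s) → IsoBound (+ 2 * M) s Θ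
    split (inj₁ g) = first (h ⊕ g ⟫ solve (M ∷ s ∷ Θ ∷ []))
    split (inj₂ g) = second (h ⊕ g ⟫ solve (M ∷ s ∷ Θ ∷ []))

  mean-second-third : ∀ M s Θ → + 5 * M ≤ + 4 * Θ → IsoBound (+ 2 * M) s Θ
  mean-second-third M s Θ h = split (≤-total (+ 4 * s) (+ 3 * M))
    where
    split : (+ 4 * s) ≤ (+ 3 * M) ⊎ (+ 3 * M) ≤ (+ 4 * s) → IsoBound (+ 2 * M) s Θ
    split (inj₁ g) = second (h ⊕ g ⟫ solve (M ∷ s ∷ Θ ∷ []))
    split (inj₂ g) = third (h ⊕ g ⟫ solve (M ∷ s ∷ Θ ∷ []))

  mean-first-third : ∀ M s Θ → + 4 * s + + 4 * M ≤ + 4 * Θ → IsoBound (+ 2 * M) s Θ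
  mean-first-third M s Θ h = split (≤-total (+ 8 * s) (+ 4 * M))
    where
    split : (+ 8 * s) ≤ (+ 4 * M) ⊎ (+ 4 * M) ≤ (+ 8 * s) → IsoBound (+ 2 * M) s Θ
    split (inj₁ g) = first (h ⊕ g ⟫ solve (M ∷ s ∷ Θ ∷ []))
    split (inj₂ g) = third (h ⊕ g ⟫ solve (M ∷ s ∷ Θ ∷ []))

  -- Induction step on the dimension: `p ≤ q` are the sizes of the two halves, and `δ` counts the
  -- edges between them. The bound on the complement of the denser half serves one case that the
  -- other two bounds do not settle.
  IsoBound-step : ∀ M p q α β δ → + 0 ≤ p → p ≤ q → q ≤ M → q - p ≤ δ →
    IsoBound M p α → IsoBound M q β → IsoBound M (M - q) β →
    IsoBound (+ 2 * M) (p + q) (α + β + δ)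
  IsoBound-step M p q α β δ 0≤p p≤q q≤M d≤δ = go
    where
    d4 : + 4 * (q - p) ≤ + 4 * δ
    d4 = *-monoˡ-≤-nonNeg (+ 4) d≤δ
    12pq : + 12 * p ≤ + 12 * q
    12pq = *-monoˡ-≤-nonNeg (+ 12) p≤q
    8pq : + 8 * p ≤ + 8 * q
    8pq = *-monoˡ-≤-nonNeg (+ 8) p≤q
    4pq : + 4 * p ≤ + 4 * q
    4pq = *-monoˡ-≤-nonNeg (+ 4) p≤q
    4qM : + 4 * q ≤ + 4 * M
    4qM = *-monoˡ-≤-nonNeg (+ 4) q≤M
    4p : + 0 ≤ + 4 * p
    4p = *-monoˡ-≤-nonNeg (+ 4) 0≤p
    8p : + 0 ≤ + 8 * p
    8p = *-monoˡ-≤-nonNeg (+ 8) 0≤p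
    12p : + 0 ≤ + 12 * p
    12p = *-monoˡ-≤-nonNeg (+ 12) 0≤p
    go : IsoBound M p α → IsoBound M q β → IsoBound M (M - q) β →
         IsoBound (+ 2 * M) (p + q) (α + β + δ)
    go (first a) (first b) _ =
      first (a ⊕ b ⊕ d4 ⊕ 4pq ⟫ solve (M ∷ p ∷ q ∷ α ∷ β ∷ δ ∷ []))
    go (second a) (second b) _ =
      second (a ⊕ b ⊕ d4 ⊕ 4pq ⟫ solve (M ∷ p ∷ q ∷ α ∷ β ∷ δ ∷ []))
    go (third a) (third b) _ =
      third (a ⊕ b ⊕ d4 ⊕ 4pq ⟫ solve (M ∷ p ∷ q ∷ α ∷ β ∷ δ ∷ []))
    -- Mixed alternatives: together with the crossing edges the two bounds reach the average of the
    -- same two alternatives at `p + q`.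
    go (first a) (second b) _ =
      mean-first-second M (p + q) (α + β + δ) (a ⊕ b ⊕ d4 ⟫ solve (M ∷ p ∷ q ∷ α ∷ β ∷ δ ∷ []))
    go (second a) (first b) _ =
      mean-first-second M (p + q) (α + β + δ) (a ⊕ b ⊕ d4 ⊕ 8pq ⟫ solve (M ∷ p ∷ q ∷ α ∷ β ∷ δ ∷ []))
    go (second a) (third b) _ =
      mean-second-third M (p + q) (α + β + δ) (a ⊕ b ⊕ d4 ⟫ solve (M ∷ p ∷ q ∷ α ∷ β ∷ δ ∷ []))
    go (third a) (second b) _ =
      mean-second-third M (p + q) (α + β + δ) (a ⊕ b ⊕ d4 ⊕ 8pq ⟫ solve (M ∷ p ∷ q ∷ α ∷ β ∷ δ ∷ []))
    go (third a) (first b) _ =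
      mean-first-third M (p + q) (α + β + δ) (a ⊕ b ⊕ d4 ⊕ 12pq ⟫ solve (M ∷ p ∷ q ∷ α ∷ β ∷ δ ∷ []))
    -- The sum here is only `8p + 4M`, short of the average `4(p + q) + 4M` by `4(q - p)`. If
    -- `q - p` is at most `M / 2`, it still reaches the second alternative; otherwise `c` replaces
    -- `b`.
    go (first a) (third b) c = near-or-far (≤-total (+ 4 * (q - p)) (+ 2 * M)) c
      where
      near-or-far : + 4 * (q - p) ≤ + 2 * M ⊎ + 2 * M ≤ + 4 * (q - p) → IsoBound M (M - q) β →
                    IsoBound (+ 2 * M) (p + q) (α + β + δ)
      near-or-far (inj₁ g) _ = second (a ⊕ b ⊕ d4 ⊕ g ⟫ solve (M ∷ p ∷ q ∷ α ∷ β ∷ δ ∷ []))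
      near-or-far (inj₂ g) (first c) =
        third (a ⊕ c ⊕ d4 ⊕ 4qM ⊕ 12p
          ⟫ solve (M ∷ p ∷ q ∷ α ∷ β ∷ δ ∷ []))
      near-or-far (inj₂ g) (second c) = split (≤-total (+ 4 * q) (+ 3 * M))
        where
        split : + 4 * q ≤ + 3 * M ⊎ + 3 * M ≤ + 4 * q → IsoBound (+ 2 * M) (p + q) (α + β + δ)
        split (inj₁ e) = second (a ⊕ c ⊕ d4 ⊕ e ⊕ 4p
          ⟫ solve (M ∷ p ∷ q ∷ α ∷ β ∷ δ ∷ []))
        split (inj₂ e) = third (a ⊕ c ⊕ d4 ⊕ e ⊕ 12p
          ⟫ solve (M ∷ p ∷ q ∷ α ∷ β ∷ δ ∷ []))
      near-or-far (inj₂ g) (third c) =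
        second (a ⊕ c ⊕ d4 ⊕ g ⊕ 8p ⟫ solve (M ∷ p ∷ q ∷ α ∷ β ∷ δ ∷ []))

  -- Three times the first hypothesis plus the second eliminates `B`, the sum of the squared biases.
  level-one-combine : ∀ N k E B → + 4 * (N * k) ≤ N * E + + 2 * B + + 4 * (k * k) → + 6 * B ≤ N * E →
    + 12 * (k * (N - k)) ≤ + 4 * (N * E)
  level-one-combine N k E B p q = p3 ⊕ q ⟫ solve (N ∷ k ∷ E ∷ B ∷ [])
    where
    p3 : + 3 * (+ 4 * (N * k)) ≤ + 3 * (N * E + + 2 * B + + 4 * (k * k))
    p3 = *-monoˡ-≤-nonNeg (+ 3) p

  -- On densities from 1/8 to 3/8 the minimum of `3x`, `x + 1/4` and `1 - x` is `x + 1/4`; the end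
  -- points are where it crosses the other two.
  IsoBound-middle : ∀ M p α → M ≤ + 8 * p → + 8 * p ≤ + 3 * M → IsoBound M p α → + 4 * p + M ≤ + 4 * α
  IsoBound-middle M p α l u (first a) = a ⊕ l ⟫ solve (M ∷ p ∷ α ∷ [])
  IsoBound-middle M p α l u (second a) = a
  IsoBound-middle M p α l u (third a) = a ⊕ u ⟫ solve (M ∷ p ∷ α ∷ [])

  -- The densities `p / M` and `(M - q) / M` lie in the middle range, and the two bounds `x + 1/4`
  -- plus the crossing edges cancel `p` and `q` exactly, leaving `6M`.
  large-bias-combine : ∀ M p q α β δ → + 0 ≤ M → + 58 * M ≤ + 192 * p → p + q ≤ M →
    + 2 * M ≤ + 6 * (q - p) → q - p ≤ δ → IsoBound M p α → IsoBound M (M - q) β →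
    + 6 * M ≤ + 4 * (α + β + δ)
  large-bias-combine M p q α β δ 0≤M p-large s≤M b-large d≤δ a b =
    IsoBound-middle M p α p-lower p-upper a ⊕ IsoBound-middle M (M - q) β q-upper q-lower b ⊕ d4
      ⟫ solve (M ∷ p ∷ q ∷ α ∷ β ∷ δ ∷ [])
    where
    d4 : + 4 * (q - p) ≤ + 4 * δ
    d4 = *-monoˡ-≤-nonNeg (+ 4) d≤δ
    34M : + 0 ≤ + 34 * M
    34M = *-monoˡ-≤-nonNeg (+ 34) 0≤M
    2M : + 0 ≤ + 2 * M
    2M = *-monoˡ-≤-nonNeg (+ 2) 0≤M
    s12 : + 12 * (p + q) ≤ + 12 * M
    s12 = *-monoˡ-≤-nonNeg (+ 12) s≤M
    b2 : + 2 * (+ 2 * M) ≤ + 2 * (+ 6 * (q - p))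
    b2 = *-monoˡ-≤-nonNeg (+ 2) b-large
    b32 : + 32 * (+ 2 * M) ≤ + 32 * (+ 6 * (q - p))
    b32 = *-monoˡ-≤-nonNeg (+ 32) b-large
    s8 : + 8 * (p + q) ≤ + 8 * M
    s8 = *-monoˡ-≤-nonNeg (+ 8) s≤M
    p-lower′ : + 24 * M ≤ + 24 * (+ 8 * p)
    p-lower′ = p-large ⊕ 34M ⟫ solve (M ∷ p ∷ [])
    p-lower : M ≤ + 8 * p
    p-lower = *-cancelˡ-≤-pos M (+ 8 * p) (+ 24) p-lower′
    p-upper′ : + 3 * (+ 8 * p) ≤ + 3 * (+ 3 * M)
    p-upper′ = s12 ⊕ b2 ⊕ 0≤M ⟫ solve (M ∷ p ∷ q ∷ [])
    p-upper : + 8 * p ≤ + 3 * M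
    p-upper = *-cancelˡ-≤-pos (+ 8 * p) (+ 3 * M) (+ 3) p-upper′
    q-upper : M ≤ + 8 * (M - q)
    q-upper = p-lower ⊕ s8 ⟫ solve (M ∷ p ∷ q ∷ [])
    -- The tightest estimate: `q / M` is at least 29/96 + 1/3 = 61/96, so the complement has density
    -- at most 35/96, just below 3/8 = 36/96.
    q-lower′ : + 24 * (+ 8 * (M - q)) ≤ + 24 * (+ 3 * M)
    q-lower′ = b32 ⊕ p-large ⊕ 2M ⟫ solve (M ∷ p ∷ q ∷ [])
    q-lower : + 8 * (M - q) ≤ + 3 * M
    q-lower = *-cancelˡ-≤-pos (+ 8 * (M - q)) (+ 3 * M) (+ 24) q-lower′

  -- The conclusion of this lemma and the next is N f(k / N) ≤ θ with denominators cleared.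
  three-quarters-suffices : ∀ N k θ → + 0 ≤ N → + 0 ≤ (+ 2 * k - N) * (+ 2 * k - N) →
    + 3 * N ≤ + 4 * θ →
    + 84 * (N * N) - + 256 * ((+ 2 * k - N) * (+ 2 * k - N)) ≤ + 112 * (N * θ)
  three-quarters-suffices N k θ 0≤N 0≤s h = h′ ⊕ s′ ⟫ solve (N ∷ k ∷ θ ∷ [])
    where
    h′ : + 28 * (N * (+ 3 * N)) ≤ + 28 * (N * (+ 4 * θ))
    h′ = *-monoˡ-≤-nonNeg (+ 28) (*-monoˡ-≤-nonNeg N {{nonNegative 0≤N}} h)
    s′ : + 0 ≤ + 256 * ((+ 2 * k - N) * (+ 2 * k - N))
    s′ = *-monoˡ-≤-nonNeg (+ 256) 0≤s

  three-variance-suffices : ∀ N k θ → + 0 ≤ (+ 2 * k - N) * (+ 2 * k - N) →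
    + 12 * (k * (N - k)) ≤ + 4 * (N * θ) →
    + 84 * (N * N) - + 256 * ((+ 2 * k - N) * (+ 2 * k - N)) ≤ + 112 * (N * θ)
  three-variance-suffices N k θ 0≤s h = h′ ⊕ s′ ⟫ solve (N ∷ k ∷ θ ∷ [])
    where
    h′ : + 28 * (+ 12 * (k * (N - k))) ≤ + 28 * (+ 4 * (N * θ))
    h′ = *-monoˡ-≤-nonNeg (+ 28) h
    -- 172 = 256 - 84, since `336 k (N - k) = 84 (N² - (2k - N)²)`.
    s′ : + 0 ≤ + 172 * ((+ 2 * k - N) * (+ 2 * k - N))
    s′ = *-monoˡ-≤-nonNeg (+ 172) 0≤s

module Hypercube where

  open LinearInequalities
  open import Data.Bool using (Bool; true; false; not; _∧_; _xor_)
  open import Data.Bool.Properties using (∧-identityʳ; ∧-zeroʳ) renaming (_≟_ to _≟B_)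
  open import Data.Fin using (Fin; zero; suc)
  open import Data.Fin.Properties using (any?)
  open import Data.Integer using (ℤ; +_; -[1+_]; _+_; _-_; _*_; -_; _≤_; _<_; _<?_; +≤+; -≤+; nonNegative)
  open import Data.Integer.Properties
  open import Algebra.Properties.CommutativeSemigroup +-commutativeSemigroup using (interchange)
  open import Data.Integer.Tactic.RingSolver using (solve-∀)
  open import Data.List using (List; []; _∷_; length; filter; foldr; map; tabulate; concatMap; allFin)
  open import Data.List.Membership.Propositional using (_∈_)
  open import Data.List.Membership.Propositional.Properties using (∈-allFin)
  open import Data.List.Properties using (filter-++; length-++; map-tabulate)
  open import Data.List.Relation.Unary.Any using (here; there)
  open import Data.Nat using (ℕ; zero; suc; z≤n)
  import Data.Nat as ℕ
  import Data.Nat.Properties as ℕ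
  import Data.Nat.Tactic.RingSolver as ℕ
  open import Data.Product using (_×_; _,_; proj₁; proj₂)
  open import Data.Rational using (toℚᵘ; _/_) renaming (_+_ to _+ℚ_; _-_ to _-ℚ_; _*_ to _*ℚ_; _≤_ to _≤ℚ_; _<_ to _<ℚ_; -_ to -ℚ_)
  open import Data.Rational.Properties using (toℚᵘ-fromℚᵘ; toℚᵘ-homo-+; toℚᵘ-homo-*; toℚᵘ-homo‿-; toℚᵘ-cancel-≤; toℚᵘ-mono-<)
  open import Data.Rational.Unnormalised using (ℚᵘ; mkℚᵘ; _≃_; *≤*; *<*) renaming (_+_ to _+ᵘ_; _*_ to _*ᵘ_; -_ to -ᵘ_)
  import Data.Rational.Unnormalised.Properties as ℚᵘ
  open import Data.Vec using (Vec; []; _∷_; insertAt; lookup)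
  open import Data.Vec.Properties using (insertAt-lookup)
  open import Function using (_∘_; id)
  open import Relation.Nullary using (yes; no)
  open import Relation.Nullary.Decidable using (does; _⊎-dec_)

  private variable
    n : ℕ
    A B : Set

  -- Sums over the cube and energy

  -- The number of vertices, as an integer that unfolds along with the induction on the dimension.
  vol : ℕ → ℤ
  vol zero = + 1
  vol (suc n) = + 2 * vol n

  ∑ : (Vec Bool n → ℤ) → ℤ
  ∑ {zero} f = f []
  ∑ {suc n} f = ∑ (f ∘ (false ∷_)) + ∑ (f ∘ (true ∷_))

  ⅀ : (Fin n → ℤ) → ℤ
  ⅀ {zero} c = + 0
  ⅀ {suc n} c = c zero + ⅀ (c ∘ suc)

  minus-interchange : ∀ a b c d → (a - b) + (c - d) ≡ (a + c) - (b + d)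
  minus-interchange = solve-∀

  ∑-cong : {f g : Vec Bool n → ℤ} → (∀ x → f x ≡ g x) → ∑ f ≡ ∑ g
  ∑-cong {zero} e = e []
  ∑-cong {suc n} e = cong₂ _+_ (∑-cong (e ∘ (false ∷_))) (∑-cong (e ∘ (true ∷_)))

  ∑-+ : (f g : Vec Bool n → ℤ) → ∑ (λ x → f x + g x) ≡ ∑ f + ∑ g
  ∑-+ {zero} f g = refl
  ∑-+ {suc n} f g = trans
    (cong₂ _+_ (∑-+ (f ∘ (false ∷_)) (g ∘ (false ∷_))) (∑-+ (f ∘ (true ∷_)) (g ∘ (true ∷_))))
    (interchange (∑ (f ∘ (false ∷_))) (∑ (g ∘ (false ∷_))) (∑ (f ∘ (true ∷_))) (∑ (g ∘ (true ∷_))))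

  ∑-* : (c : ℤ) (f : Vec Bool n → ℤ) → ∑ (λ x → c * f x) ≡ c * ∑ f
  ∑-* {zero} c f = refl
  ∑-* {suc n} c f = trans
    (cong₂ _+_ (∑-* c (f ∘ (false ∷_))) (∑-* c (f ∘ (true ∷_))))
    (sym (*-distribˡ-+ c (∑ (f ∘ (false ∷_))) (∑ (f ∘ (true ∷_)))))

  ∑-- : (f g : Vec Bool n → ℤ) → ∑ (λ x → f x - g x) ≡ ∑ f - ∑ g
  ∑-- {zero} f g = refl
  ∑-- {suc n} f g = trans
    (cong₂ _+_ (∑-- (f ∘ (false ∷_)) (g ∘ (false ∷_))) (∑-- (f ∘ (true ∷_)) (g ∘ (true ∷_))))
    (minus-interchange (∑ (f ∘ (false ∷_))) (∑ (g ∘ (false ∷_))) (∑ (f ∘ (true ∷_))) (∑ (g ∘ (true ∷_))))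

  ∑-mono : {f g : Vec Bool n → ℤ} → (∀ x → f x ≤ g x) → ∑ f ≤ ∑ g
  ∑-mono {zero} h = h []
  ∑-mono {suc n} h = ∑-mono (h ∘ (false ∷_)) ⊕ ∑-mono (h ∘ (true ∷_))

  ∑-const : ∀ n c → ∑ {n} (λ _ → c) ≡ c * vol n
  ∑-const zero c = sym (*-identityʳ c)
  ∑-const (suc n) c = trans (cong₂ _+_ (∑-const n c) (∑-const n c)) (double c (vol n))
    where
    double : ∀ c v → c * v + c * v ≡ c * (+ 2 * v)
    double = solve-∀

  ⅀-cong : {b c : Fin n → ℤ} → (∀ i → b i ≡ c i) → ⅀ b ≡ ⅀ c
  ⅀-cong {zero} e = refl
  ⅀-cong {suc n} e = cong₂ _+_ (e zero) (⅀-cong (e ∘ suc))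

  ⅀-+ : (b c : Fin n → ℤ) → ⅀ (λ i → b i + c i) ≡ ⅀ b + ⅀ c
  ⅀-+ {zero} b c = refl
  ⅀-+ {suc n} b c = trans (cong (_+_ (b zero + c zero)) (⅀-+ (b ∘ suc) (c ∘ suc)))
    (interchange (b zero) (c zero) (⅀ (b ∘ suc)) (⅀ (c ∘ suc)))

  sq : ℤ → ℤ
  sq a = a * a

  0≤sq : ∀ a → + 0 ≤ sq a
  0≤sq (+ zero) = ≤-refl
  0≤sq (+ suc a) = +≤+ z≤n
  0≤sq -[1+ a ] = +≤+ z≤n

  -- The Dirichlet form: squared differences summed over all edges, which is the edge boundary when
  -- `f` is an indicator. General `f` is allowed because sums and differences of the two halves are
  -- no longer indicators.
  energy : (Vec Bool n → ℤ) → ℤ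
  energy {zero} f = + 0
  energy {suc n} f =
    energy (f ∘ (false ∷_)) + energy (f ∘ (true ∷_)) + ∑ (λ x → sq (f (true ∷ x) - f (false ∷ x)))

  ∑-nonNeg : {f : Vec Bool n → ℤ} → (∀ x → + 0 ≤ f x) → + 0 ≤ ∑ f
  ∑-nonNeg {n} h = ≤-trans (≤-reflexive (sym (∑-const n (+ 0)))) (∑-mono h)

  0≤energy : (f : Vec Bool n → ℤ) → + 0 ≤ energy f
  0≤energy {zero} f = ≤-refl
  0≤energy {suc n} f = 0≤energy (f ∘ (false ∷_)) ⊕ 0≤energy (f ∘ (true ∷_))
    ⊕ ∑-nonNeg (λ x → 0≤sq (f (true ∷ x) - f (false ∷ x)))

  0≤vol : ∀ n → + 0 ≤ vol n
  0≤vol zero = +≤+ z≤n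
  0≤vol (suc n) = *-monoˡ-≤-nonNeg (+ 2) (0≤vol n)

  parallelogram : ∀ a b → sq (a + b) + sq (b - a) ≡ + 2 * (sq a + sq b)
  parallelogram = identity
    where
    identity : ∀ a b → (a + b) * (a + b) + (b - a) * (b - a) ≡ + 2 * (a * a + b * b)
    identity = solve-∀

  ∑-parallelogram : (f g : Vec Bool n → ℤ) →
    ∑ (λ x → sq (f x + g x)) + ∑ (λ x → sq (g x - f x)) ≡ + 2 * (∑ (sq ∘ f) + ∑ (sq ∘ g))
  ∑-parallelogram f g = trans (sym (∑-+ (λ x → sq (f x + g x)) (λ x → sq (g x - f x))))
    (trans (∑-cong (λ x → parallelogram (f x) (g x)))
    (trans (∑-* (+ 2) (λ x → sq (f x) + sq (g x)))
    (cong (_*_ (+ 2)) (∑-+ (sq ∘ f) (sq ∘ g)))))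

  -- The energy is a quadratic form, hence obeys the parallelogram law.
  energy-parallelogram : (f g : Vec Bool n → ℤ) →
    energy (λ x → f x + g x) + energy (λ x → g x - f x) ≡ + 2 * (energy f + energy g)
  energy-parallelogram {zero} f g = refl
  energy-parallelogram {suc n} f g = trans
    (regroup (energy (λ x → f₀ x + g₀ x)) (energy (λ x → f₁ x + g₁ x)) _
             (energy (λ x → g₀ x - f₀ x)) (energy (λ x → g₁ x - f₁ x)) _)
    (trans
      (cong₂ _+_ (cong₂ _+_ (energy-parallelogram f₀ g₀) (energy-parallelogram f₁ g₁))
        (trans
          (cong₂ _+_ (∑-cong (λ x → cong sq (sym (minus-interchange (f₁ x) (f₀ x) (g₁ x) (g₀ x)))))
                     (∑-cong (λ x → cong sq (diff-- (f₁ x) (g₁ x) (f₀ x) (g₀ x)))))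
          (∑-parallelogram (λ x → f₁ x - f₀ x) (λ x → g₁ x - g₀ x))))
      (collect (energy f₀) (energy g₀) (energy f₁) (energy g₁) _ _))
    where
    f₀ f₁ g₀ g₁ : Vec Bool n → ℤ
    f₀ = f ∘ (false ∷_)
    f₁ = f ∘ (true ∷_)
    g₀ = g ∘ (false ∷_)
    g₁ = g ∘ (true ∷_)
    regroup : ∀ a b c a' b' c' → (a + b + c) + (a' + b' + c') ≡ (a + a') + (b + b') + (c + c')
    regroup = solve-∀
    diff-- : ∀ a b c d → (b - a) - (d - c) ≡ (b - d) - (a - c)
    diff-- = solve-∀
    collect : ∀ a b c d e e' →
      + 2 * (a + b) + + 2 * (c + d) + + 2 * (e + e') ≡ + 2 * ((a + c + e) + (b + d + e'))
    collect = solve-∀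

  -- Spectral inequalities: Poincaré and its refinement at level one.

  -- Spectral gap: with unnormalised Fourier coefficients, `vol n * energy f` weights the squared
  -- coefficient of a set `A` by twice the size of `A`, which is at least 2 unless `A` is empty.
  poincaré : (f : Vec Bool n → ℤ) →
    + 2 * (vol n * ∑ (sq ∘ f)) ≤ vol n * energy f + + 2 * sq (∑ f)
  poincaré {zero} f = ≤-reflexive (base (f []))
    where
    base : ∀ a → + 2 * (+ 1 * (a * a)) ≡ + 1 * + 0 + + 2 * (a * a)
    base = solve-∀
  poincaré {suc n} f = step (vol n) (energy f₀ + energy f₁) (energy u) (energy v)
    (∑ (sq ∘ f₀) + ∑ (sq ∘ f₁)) (∑ (sq ∘ u)) (∑ (sq ∘ v)) (sq (∑ f₀ + ∑ f₁))
    (subst (λ s → + 2 * (vol n * ∑ (sq ∘ u)) ≤ vol n * energy u + + 2 * sq s) (∑-+ f₀ f₁) (poincaré u))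
    (*-monoˡ-≤-nonNeg (vol n) {{nonNegative (0≤vol n)}} (0≤energy v))
    (energy-parallelogram f₀ f₁) (∑-parallelogram f₀ f₁)
    where
    f₀ f₁ u v : Vec Bool n → ℤ
    f₀ = f ∘ (false ∷_)
    f₁ = f ∘ (true ∷_)
    u x = f₀ x + f₁ x
    v x = f₁ x - f₀ x
    step : ∀ M e eᵤ eᵥ F U V s →
      + 2 * (M * U) ≤ M * eᵤ + + 2 * s → M * + 0 ≤ M * eᵥ →
      eᵤ + eᵥ ≡ + 2 * e → U + V ≡ + 2 * F →
      + 2 * ((+ 2 * M) * F) ≤ (+ 2 * M) * (e + V) + + 2 * s
    step M e eᵤ eᵥ F U V s ih nn pe pf = begin
      + 2 * ((+ 2 * M) * F)                       ≡⟨ move M F ⟩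
      + 2 * (M * (+ 2 * F))                       ≡⟨ cong (λ z → + 2 * (M * z)) (sym pf) ⟩
      + 2 * (M * (U + V))                         ≡⟨ expand M U V ⟩
      -- Induction is applied to `u` only. The edges across the first coordinate supply the whole
      -- `2MV`, so nonnegativity of the energy of `v` is enough.
      + 2 * (M * U) + M * + 0 + + 2 * (M * V)     ≤⟨ ih ⊕ nn ⊕ ≤-refl ⟩
      M * eᵤ + + 2 * s + M * eᵥ + + 2 * (M * V)   ≡⟨ gather M eᵤ eᵥ s V ⟩
      M * (eᵤ + eᵥ) + + 2 * (M * V) + + 2 * s     ≡⟨ cong (λ z → M * z + + 2 * (M * V) + + 2 * s) pe ⟩
      M * (+ 2 * e) + + 2 * (M * V) + + 2 * s     ≡⟨ factor M e s V ⟩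
      (+ 2 * M) * (e + V) + + 2 * s               ∎
      where
      open ≤-Reasoning
      move : ∀ M F → + 2 * ((+ 2 * M) * F) ≡ + 2 * (M * (+ 2 * F))
      move = solve-∀
      expand : ∀ M U V → + 2 * (M * (U + V)) ≡ + 2 * (M * U) + M * + 0 + + 2 * (M * V)
      expand = solve-∀
      gather : ∀ M x y s V →
        M * x + + 2 * s + M * y + + 2 * (M * V) ≡ M * (x + y) + + 2 * (M * V) + + 2 * s
      gather = solve-∀
      factor : ∀ M e s V → M * (+ 2 * e) + + 2 * (M * V) + + 2 * s ≡ (+ 2 * M) * (e + V) + + 2 * s
      factor = solve-∀

  -- Up to sign, the Fourier coefficient of the singleton `i`.
  bias : Fin n → (Vec Bool n → ℤ) → ℤ
  bias zero f = ∑ (f ∘ (true ∷_)) - ∑ (f ∘ (false ∷_))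
  bias (suc i) f = bias i (f ∘ (false ∷_)) + bias i (f ∘ (true ∷_))

  bias-+ : (i : Fin n) (f g : Vec Bool n → ℤ) → bias i (λ x → f x + g x) ≡ bias i f + bias i g
  bias-+ zero f g = trans
    (cong₂ _-_ (∑-+ (f ∘ (true ∷_)) (g ∘ (true ∷_))) (∑-+ (f ∘ (false ∷_)) (g ∘ (false ∷_))))
    (sym (minus-interchange (∑ (f ∘ (true ∷_))) (∑ (f ∘ (false ∷_))) (∑ (g ∘ (true ∷_))) (∑ (g ∘ (false ∷_)))))
  bias-+ (suc i) f g = trans
    (cong₂ _+_ (bias-+ i (f ∘ (false ∷_)) (g ∘ (false ∷_))) (bias-+ i (f ∘ (true ∷_)) (g ∘ (true ∷_))))
    (interchange (bias i (f ∘ (false ∷_))) (bias i (g ∘ (false ∷_)))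
                 (bias i (f ∘ (true ∷_))) (bias i (g ∘ (true ∷_))))

  -- The Fourier expansion in the first coordinate is (u , v) = (f₀ + f₁ , f₁ − f₀): u keeps its
  -- level, so induction applies to it, while v moves up one level, so Poincaré suffices for it.
  level-one : (f : Vec Bool n → ℤ) →
    + 4 * (vol n * ∑ (sq ∘ f)) ≤
    vol n * energy f + + 2 * ⅀ (λ i → sq (bias i f)) + + 4 * sq (∑ f)
  level-one {zero} f = ≤-reflexive (base (f []))
    where
    base : ∀ a → + 4 * (+ 1 * (a * a)) ≡ + 1 * + 0 + + 2 * + 0 + + 4 * (a * a)
    base = solve-∀
  level-one {suc n} f = step (vol n) (energy f₀ + energy f₁) (energy u) (energy v)
    (∑ (sq ∘ f₀) + ∑ (sq ∘ f₁)) (∑ (sq ∘ u)) (∑ (sq ∘ v)) (sq (∑ f₀ + ∑ f₁)) (sq (∑ f₁ - ∑ f₀)) W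
    (subst (λ s → + 4 * (vol n * ∑ (sq ∘ u)) ≤ vol n * energy u + + 2 * W + + 4 * sq s) (∑-+ f₀ f₁)
      (subst (λ b → + 4 * (vol n * ∑ (sq ∘ u)) ≤ vol n * energy u + + 2 * b + + 4 * sq (∑ u))
        (⅀-cong (λ i → cong sq (bias-+ i f₀ f₁))) (level-one u)))
    (subst (λ s → + 2 * (vol n * ∑ (sq ∘ v)) ≤ vol n * energy v + + 2 * sq s) (∑-- f₁ f₀) (poincaré v))
    (energy-parallelogram f₀ f₁) (∑-parallelogram f₀ f₁)
    where
    f₀ f₁ u v : Vec Bool n → ℤ
    f₀ = f ∘ (false ∷_)
    f₁ = f ∘ (true ∷_)
    u x = f₀ x + f₁ x
    v x = f₁ x - f₀ x
    W : ℤ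
    W = ⅀ (λ i → sq (bias i f₀ + bias i f₁))
    step : ∀ M e eᵤ eᵥ F U V s d b →
      + 4 * (M * U) ≤ M * eᵤ + + 2 * b + + 4 * s →
      + 2 * (M * V) ≤ M * eᵥ + + 2 * d →
      eᵤ + eᵥ ≡ + 2 * e → U + V ≡ + 2 * F →
      + 4 * ((+ 2 * M) * F) ≤ (+ 2 * M) * (e + V) + + 2 * (d + b) + + 4 * s
    step M e eᵤ eᵥ F U V s d b ih pv pe pf = begin
      + 4 * ((+ 2 * M) * F)
        ≡⟨ move M F ⟩
      + 4 * (M * (+ 2 * F))
        ≡⟨ cong (λ z → + 4 * (M * z)) (sym pf) ⟩
      + 4 * (M * (U + V))
        ≡⟨ expand M U V ⟩
      + 4 * (M * U) + + 2 * (M * V) + + 2 * (M * V)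
        -- Half of `4MV` is paid for by Poincaré for `v`, whose mean term `d` is the squared bias in
        -- the first direction; the other half is the energy across that direction.
        ≤⟨ ih ⊕ pv ⊕ ≤-refl ⟩
      (M * eᵤ + + 2 * b + + 4 * s) + (M * eᵥ + + 2 * d) + + 2 * (M * V)
        ≡⟨ gather (M * eᵤ) (M * eᵥ) (M * V) b s d ⟩
      (M * eᵤ + M * eᵥ) + + 2 * (M * V) + (+ 2 * (d + b) + + 4 * s)
        ≡⟨ cong (λ z → z + + 2 * (M * V) + (+ 2 * (d + b) + + 4 * s)) (sym (*-distribˡ-+ M eᵤ eᵥ)) ⟩
      M * (eᵤ + eᵥ) + + 2 * (M * V) + (+ 2 * (d + b) + + 4 * s)
        ≡⟨ cong (λ z → M * z + + 2 * (M * V) + (+ 2 * (d + b) + + 4 * s)) pe ⟩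
      M * (+ 2 * e) + + 2 * (M * V) + (+ 2 * (d + b) + + 4 * s)
        ≡⟨ cong (λ z → z + (+ 2 * (d + b) + + 4 * s)) (factor M e V) ⟩
      (+ 2 * M) * (e + V) + (+ 2 * (d + b) + + 4 * s)
        ≡⟨ sym (+-assoc ((+ 2 * M) * (e + V)) (+ 2 * (d + b)) (+ 4 * s)) ⟩
      (+ 2 * M) * (e + V) + + 2 * (d + b) + + 4 * s ∎
      where
      open ≤-Reasoning
      move : ∀ M F → + 4 * ((+ 2 * M) * F) ≡ + 4 * (M * (+ 2 * F))
      move = solve-∀
      expand : ∀ M U V → + 4 * (M * (U + V)) ≡ + 4 * (M * U) + + 2 * (M * V) + + 2 * (M * V)
      expand = solve-∀
      gather : ∀ x y z b s d →
        (x + + 2 * b + + 4 * s) + (y + + 2 * d) + + 2 * z ≡ (x + y) + + 2 * z + (+ 2 * (d + b) + + 4 * s)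
      gather = solve-∀
      factor : ∀ M e V → M * (+ 2 * e) + + 2 * (M * V) ≡ (+ 2 * M) * (e + V)
      factor = solve-∀

  -- Slicing along an arbitrary direction.

  restrict : Fin (suc n) → Bool → (Vec Bool (suc n) → A) → Vec Bool n → A
  restrict i a f y = f (insertAt y i a)

  ∑-restrict : (i : Fin (suc n)) (f : Vec Bool (suc n) → ℤ) →
    ∑ f ≡ ∑ (restrict i false f) + ∑ (restrict i true f)
  ∑-restrict zero f = refl
  ∑-restrict {suc n} (suc i) f = trans
    (cong₂ _+_ (∑-restrict i (f ∘ (false ∷_))) (∑-restrict i (f ∘ (true ∷_))))
    (interchange (∑ (restrict i false (f ∘ (false ∷_)))) (∑ (restrict i true (f ∘ (false ∷_))))
                 (∑ (restrict i false (f ∘ (true ∷_)))) (∑ (restrict i true (f ∘ (true ∷_)))))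

  -- The recursion of `energy` favours the first coordinate; regrouping the edges shows that any
  -- direction may play its role.
  energy-restrict : (i : Fin (suc n)) (f : Vec Bool (suc n) → ℤ) →
    energy f ≡ energy (restrict i false f) + energy (restrict i true f)
               + ∑ (λ y → sq (restrict i true f y - restrict i false f y))
  energy-restrict zero f = refl
  energy-restrict {suc n} (suc i) f = trans
    (cong₂ _+_ (cong₂ _+_ (energy-restrict i f₀) (energy-restrict i f₁))
               (∑-restrict i (λ x → sq (f₁ x - f₀ x))))
    (regroup (energy (restrict i false f₀)) (energy (restrict i true f₀)) _
             (energy (restrict i false f₁)) (energy (restrict i true f₁)) _ _ _)
    where
    f₀ f₁ : Vec Bool (suc n) → ℤ
    f₀ = f ∘ (false ∷_)
    f₁ = f ∘ (true ∷_)
    regroup : ∀ a b c a' b' c' d d' →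
      (a + b + c) + (a' + b' + c') + (d + d') ≡ (a + a' + d) + (b + b' + d') + (c + c')
    regroup = solve-∀

  bias-restrict : (i : Fin (suc n)) (f : Vec Bool (suc n) → ℤ) →
    bias i f ≡ ∑ (restrict i true f) - ∑ (restrict i false f)
  bias-restrict zero f = refl
  bias-restrict {suc n} (suc i) f = trans
    (cong₂ _+_ (bias-restrict i (f ∘ (false ∷_))) (bias-restrict i (f ∘ (true ∷_))))
    (minus-interchange (∑ (restrict i true (f ∘ (false ∷_)))) (∑ (restrict i false (f ∘ (false ∷_))))
                       (∑ (restrict i true (f ∘ (true ∷_)))) (∑ (restrict i false (f ∘ (true ∷_)))))

  -- Indicators of subsets

  ι : Bool → ℤ
  ι false = + 0
  ι true = + 1

  0≤ι : ∀ a → + 0 ≤ ι a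
  0≤ι false = ≤-refl
  0≤ι true = +≤+ z≤n

  ι≤1 : ∀ a → ι a ≤ + 1
  ι≤1 false = +≤+ z≤n
  ι≤1 true = ≤-refl

  ι-sq : ∀ a → sq (ι a) ≡ ι a
  ι-sq false = refl
  ι-sq true = refl

  ι-xor : ∀ a b → ι (a xor b) ≡ sq (ι b - ι a)
  ι-xor false false = refl
  ι-xor false true = refl
  ι-xor true false = refl
  ι-xor true true = refl

  ι-diff≤sq : ∀ a b → ι a - ι b ≤ sq (ι a - ι b)
  ι-diff≤sq false false = ≤-refl
  ι-diff≤sq false true = -≤+
  ι-diff≤sq true false = ≤-refl
  ι-diff≤sq true true = ≤-refl

  -- A difference of indicators is -1, 0 or 1, so its square is its absolute value.
  ι-corr : ∀ K c → - K ≤ c → c ≤ K → ∀ a b → c * (ι a - ι b) ≤ K * sq (ι a - ι b)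
  ι-corr K c l u false false = ≤-reflexive (trans (*-zeroʳ c) (sym (*-zeroʳ K)))
  ι-corr K c l u true true = ≤-reflexive (trans (*-zeroʳ c) (sym (*-zeroʳ K)))
  ι-corr K c l u true false = subst₂ _≤_ (sym (*-identityʳ c)) (sym (*-identityʳ K)) u
  ι-corr K c l u false true =
    subst₂ _≤_ (trans (sym (-1*i≡-i c)) (*-comm _ c)) (trans (neg-involutive K) (sym (*-identityʳ K)))
      (neg-mono-≤ l)

  -- Each bias is at most the number of boundary edges in its direction. The weights `c` express the
  -- resulting bound on the sum of absolute biases without absolute values.
  bias-correlation : (K : ℤ) (c : Fin n → ℤ) → (∀ i → - K ≤ c i) → (∀ i → c i ≤ K) →
    (S : Subset n) → ⅀ (λ i → c i * bias i (ι ∘ S)) ≤ K * energy (ι ∘ S)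
  bias-correlation {zero} K c l u S = ≤-reflexive (sym (*-zeroʳ K))
  bias-correlation {suc n} K c l u S = begin
    c zero * (∑ (ι ∘ S₁) - ∑ (ι ∘ S₀)) + ⅀ (λ i → c (suc i) * (bias i (ι ∘ S₀) + bias i (ι ∘ S₁)))
      ≡⟨ cong₂ _+_ head tail ⟩
    ∑ (λ x → c zero * (ι (S₁ x) - ι (S₀ x)))
      + (⅀ (λ i → c (suc i) * bias i (ι ∘ S₀)) + ⅀ (λ i → c (suc i) * bias i (ι ∘ S₁)))
      ≤⟨ ∑-mono (λ x → ι-corr K (c zero) (l zero) (u zero) (S₁ x) (S₀ x))
         ⊕ (bias-correlation K (c ∘ suc) (l ∘ suc) (u ∘ suc) S₀
            ⊕ bias-correlation K (c ∘ suc) (l ∘ suc) (u ∘ suc) S₁) ⟩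
    ∑ (λ x → K * sq (ι (S₁ x) - ι (S₀ x))) + (K * energy (ι ∘ S₀) + K * energy (ι ∘ S₁))
      ≡⟨ cong (_+ (K * energy (ι ∘ S₀) + K * energy (ι ∘ S₁))) (∑-* K (λ x → sq (ι (S₁ x) - ι (S₀ x)))) ⟩
    K * ∑ (λ x → sq (ι (S₁ x) - ι (S₀ x))) + (K * energy (ι ∘ S₀) + K * energy (ι ∘ S₁))
      ≡⟨ factor K (∑ (λ x → sq (ι (S₁ x) - ι (S₀ x)))) (energy (ι ∘ S₀)) (energy (ι ∘ S₁)) ⟩
    K * (energy (ι ∘ S₀) + energy (ι ∘ S₁) + ∑ (λ x → sq (ι (S₁ x) - ι (S₀ x)))) ∎
    where
    open ≤-Reasoning
    S₀ S₁ : Subset n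
    S₀ = S ∘ (false ∷_)
    S₁ = S ∘ (true ∷_)
    head : c zero * (∑ (ι ∘ S₁) - ∑ (ι ∘ S₀)) ≡ ∑ (λ x → c zero * (ι (S₁ x) - ι (S₀ x)))
    head = trans (cong (_*_ (c zero)) (sym (∑-- (ι ∘ S₁) (ι ∘ S₀))))
                 (sym (∑-* (c zero) (λ x → ι (S₁ x) - ι (S₀ x))))
    tail : ⅀ (λ i → c (suc i) * (bias i (ι ∘ S₀) + bias i (ι ∘ S₁))) ≡
           ⅀ (λ i → c (suc i) * bias i (ι ∘ S₀)) + ⅀ (λ i → c (suc i) * bias i (ι ∘ S₁))
    tail = trans (⅀-cong (λ i → *-distribˡ-+ (c (suc i)) (bias i (ι ∘ S₀)) (bias i (ι ∘ S₁))))
                 (⅀-+ (λ i → c (suc i) * bias i (ι ∘ S₀)) (λ i → c (suc i) * bias i (ι ∘ S₁)))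
    factor : ∀ K d e e' → K * d + (K * e + K * e') ≡ K * (e + e' + d)
    factor = solve-∀

  ⅀-* : (k : ℤ) (c : Fin n → ℤ) → ⅀ (λ i → k * c i) ≡ k * ⅀ c
  ⅀-* {zero} k c = sym (*-zeroʳ k)
  ⅀-* {suc n} k c = trans (cong (_+_ (k * c zero)) (⅀-* k (c ∘ suc)))
    (sym (*-distribˡ-+ k (c zero) (⅀ (c ∘ suc))))

  small-bias-bound : (S : Subset n) →
    (∀ i → - vol n ≤ + 6 * bias i (ι ∘ S)) → (∀ i → + 6 * bias i (ι ∘ S) ≤ vol n) →
    + 12 * (∑ (ι ∘ S) * (vol n - ∑ (ι ∘ S))) ≤ + 4 * (vol n * energy (ι ∘ S))
  small-bias-bound {n} S l u =
    level-one-combine (vol n) (∑ (ι ∘ S)) (energy (ι ∘ S)) (⅀ (λ i → sq (bias i (ι ∘ S))))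
      (subst (λ s → + 4 * (vol n * s) ≤ vol n * energy (ι ∘ S) + + 2 * ⅀ (λ i → sq (bias i (ι ∘ S)))
                                      + + 4 * sq (∑ (ι ∘ S)))
        (∑-cong (λ x → ι-sq (S x))) (level-one (ι ∘ S)))
      (subst (_≤ vol n * energy (ι ∘ S))
        (trans (⅀-cong (λ i → *-assoc (+ 6) (bias i (ι ∘ S)) (bias i (ι ∘ S)))) (⅀-* (+ 6) (λ i → sq (bias i (ι ∘ S)))))
        -- The weights are the biases themselves, times 6, so the correlation becomes six times the
        -- sum of squares.
        (bias-correlation (vol n) (λ i → + 6 * bias i (ι ∘ S)) l u S))

  0≤∑ι : (S : Subset n) → + 0 ≤ ∑ (ι ∘ S)
  0≤∑ι S = ∑-nonNeg (λ x → 0≤ι (S x))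

  ∑ι≤vol : (S : Subset n) → ∑ (ι ∘ S) ≤ vol n
  ∑ι≤vol {n} S = ≤-trans (∑-mono (λ x → ι≤1 (S x)))
    (≤-reflexive (trans (∑-const n (+ 1)) (*-identityˡ (vol n))))

  ∑ι-diff : (S T : Subset n) → ∑ (ι ∘ S) - ∑ (ι ∘ T) ≤ ∑ (λ x → sq (ι (S x) - ι (T x)))
  ∑ι-diff S T = ≤-trans (≤-reflexive (sym (∑-- (ι ∘ S) (ι ∘ T)))) (∑-mono (λ x → ι-diff≤sq (S x) (T x)))

  ∑ι-diff′ : (S T : Subset n) → ∑ (ι ∘ T) - ∑ (ι ∘ S) ≤ ∑ (λ x → sq (ι (S x) - ι (T x)))
  ∑ι-diff′ S T = ≤-trans (∑ι-diff T S) (≤-reflexive (∑-cong (λ x → flip-sq (ι (T x)) (ι (S x)))))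
    where
    flip-sq : ∀ a b → (a - b) * (a - b) ≡ (b - a) * (b - a)
    flip-sq = solve-∀

  -- Isoperimetry

  -- A set and its complement have the same boundary. Both bounds are carried through the induction
  -- because its step uses the complement of a half.
  IsoBounds : ℤ → ℤ → ℤ → Set
  IsoBounds N k θ = IsoBound N k θ × IsoBound N (N - k) θ

  -- The second component is the same step applied to the complements, whose sizes come in the
  -- reverse order.
  IsoBounds-step-≤ : ∀ M p q α β δ → + 0 ≤ p → p ≤ q → q ≤ M → q - p ≤ δ →
    IsoBounds M p α → IsoBounds M q β → IsoBounds (+ 2 * M) (p + q) (α + β + δ)
  IsoBounds-step-≤ M p q α β δ 0≤p p≤q q≤M d≤δ (a , a') (b , b') =
    IsoBound-step M p q α β δ 0≤p p≤q q≤M d≤δ a b b' ,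
    subst₂ (IsoBound (+ 2 * M)) (sum-compl M p q) (swap β α δ)
      (IsoBound-step M (M - q) (M - p) β α δ
        (i≤j⇒0≤j-i q≤M) (+-monoʳ-≤ M (neg-mono-≤ p≤q)) (0≤p ⟫ M-minus M p)
        (≤-trans (≤-reflexive (diff-compl M p q)) d≤δ) b' a'
        (subst (λ k → IsoBound M k α) (sym (compl-compl M p)) a))
    where
    sum-compl : ∀ M p q → (M - q) + (M - p) ≡ + 2 * M - (p + q)
    sum-compl = solve-∀
    swap : ∀ b a d → b + a + d ≡ a + b + d
    swap = solve-∀
    diff-compl : ∀ M p q → (M - p) - (M - q) ≡ q - p
    diff-compl = solve-∀
    compl-compl : ∀ M p → M - (M - p) ≡ p
    compl-compl = solve-∀
    M-minus : ∀ M p → M - (M - p) ≡ p - + 0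
    M-minus = solve-∀

  IsoBounds-step : ∀ M p q α β δ → + 0 ≤ p → + 0 ≤ q → p ≤ M → q ≤ M → q - p ≤ δ → p - q ≤ δ →
    IsoBounds M p α → IsoBounds M q β → IsoBounds (+ 2 * M) (p + q) (α + β + δ)
  IsoBounds-step M p q α β δ 0≤p 0≤q p≤M q≤M d d' a b with ≤-total p q
  ... | inj₁ p≤q = IsoBounds-step-≤ M p q α β δ 0≤p p≤q q≤M d a b
  ... | inj₂ q≤p = subst₂ (IsoBounds (+ 2 * M)) (+-comm q p) (cong (_+ δ) (+-comm β α))
                    (IsoBounds-step-≤ M q p β α δ 0≤q q≤p p≤M d' b a)

  isoperimetry : (S : Subset n) → IsoBounds (vol n) (∑ (ι ∘ S)) (energy (ι ∘ S))
  isoperimetry {zero} S with S []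
  ... | false = inj₁ (+≤+ z≤n) , inj₂ (inj₂ (+≤+ z≤n))
  ... | true = inj₂ (inj₂ (+≤+ z≤n)) , inj₁ (+≤+ z≤n)
  isoperimetry {suc n} S = IsoBounds-step (vol n) (∑ (ι ∘ S₀)) (∑ (ι ∘ S₁)) _ _ _
    (0≤∑ι S₀) (0≤∑ι S₁) (∑ι≤vol S₀) (∑ι≤vol S₁) (∑ι-diff S₁ S₀) (∑ι-diff′ S₁ S₀)
    (isoperimetry S₀) (isoperimetry S₁)
    where
    S₀ S₁ : Subset n
    S₀ = S ∘ (false ∷_)
    S₁ = S ∘ (true ∷_)

  -- Translation from counting

  length-filter-map : (P : B → Bool) (g : A → B) (xs : List A) →
    length (filter (λ x → P x ≟B true) (map g xs)) ≡ length (filter (λ x → P (g x) ≟B true) xs)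
  length-filter-map P g [] = refl
  length-filter-map P g (x ∷ xs) with P (g x)
  ... | true = cong suc (length-filter-map P g xs)
  ... | false = length-filter-map P g xs

  count-∑ : (P : Subset n) → + count P ≡ ∑ (ι ∘ P)
  count-∑ {zero} P with P []
  ... | true = refl
  ... | false = refl
  count-∑ {suc n} P = trans (cong +_ split) (trans (pos-+ (count P₀) (count P₁)) (cong₂ _+_ (count-∑ P₀) (count-∑ P₁)))
    where
    P₀ P₁ : Subset n
    P₀ = P ∘ (false ∷_)
    P₁ = P ∘ (true ∷_)
    xs = map (false ∷_) (allVertices n)
    ys = map (true ∷_) (allVertices n)
    split : count P ≡ count P₀ ℕ.+ count P₁
    split = trans (cong length (filter-++ (λ x → P x ≟B true) xs ys))
      (trans (length-++ (filter (λ x → P x ≟B true) xs))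
      (cong₂ ℕ._+_ (length-filter-map P (false ∷_) (allVertices n)) (length-filter-map P (true ∷_) (allVertices n))))

  sum-tabulate : (h : Fin n → ℕ) → + foldr ℕ._+_ 0 (tabulate h) ≡ ⅀ (λ i → + h i)
  sum-tabulate {zero} h = refl
  sum-tabulate {suc n} h = trans (pos-+ (h zero) _) (cong (_+_ (+ h zero)) (sum-tabulate (h ∘ suc)))

  boundary : Subset n → Fin n → Subset n
  boundary S i x = not (lookup x i) ∧ (S x xor S (flipAt i x))

  energy-⅀ : (S : Subset n) → energy (ι ∘ S) ≡ ⅀ (λ i → ∑ (ι ∘ boundary S i))
  energy-⅀ {zero} S = refl
  energy-⅀ {suc n} S = trans (cong (_+ D) (cong₂ _+_ (energy-⅀ S₀) (energy-⅀ S₁)))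
    (trans (+-comm _ D)
    (cong₂ _+_
      -- An edge is counted at its endpoint with coordinate 0, so the half with first coordinate 1
      -- contributes nothing in the first direction.
      (sym (trans (cong₂ _+_ (∑-cong (λ x → ι-xor (S₀ x) (S₁ x))) (∑-const n (+ 0))) (+-identityʳ D)))
      (sym (⅀-+ (λ i → ∑ (ι ∘ boundary S₀ i)) (λ i → ∑ (ι ∘ boundary S₁ i))))))
    where
    S₀ S₁ : Subset n
    S₀ = S ∘ (false ∷_)
    S₁ = S ∘ (true ∷_)
    D : ℤ
    D = ∑ (λ x → sq (ι (S₁ x) - ι (S₀ x)))

  theta-energy : (S : Subset n) → + theta n S ≡ energy (ι ∘ S)
  theta-energy {n} S = trans
    (cong (λ l → + foldr ℕ._+_ 0 l) (map-tabulate id (λ i → count (boundary S i))))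
    (trans (sum-tabulate (λ i → count (boundary S i)))
    (trans (⅀-cong (λ i → count-∑ (boundary S i))) (sym (energy-⅀ S))))

  halfPlaneCount-∑ : (S : Subset (suc n)) (i : Fin (suc n)) (a : Bool) →
    + halfPlaneCount S i a ≡ ∑ (ι ∘ restrict i a S)
  halfPlaneCount-∑ {n} S i a = trans (count-∑ H) (trans (∑-restrict i (ι ∘ H))
    (trans (cong₂ _+_ (∑-cong (at false)) (∑-cong (at true))) (select a)))
    where
    H : Subset (suc n)
    H x = S x ∧ does (lookup x i ≟B a)
    at : ∀ b y → ι (H (insertAt y i b)) ≡ ι (restrict i b S y ∧ does (b ≟B a))
    at b y = cong (λ c → ι (restrict i b S y ∧ does (c ≟B a))) (insertAt-lookup y i b)
    keep : ∀ b → ∑ (λ y → ι (restrict i b S y ∧ true)) ≡ ∑ (ι ∘ restrict i b S)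
    keep b = ∑-cong (λ y → cong ι (∧-identityʳ (restrict i b S y)))
    drop : ∀ b → ∑ (λ y → ι (restrict i b S y ∧ false)) ≡ + 0
    drop b = trans (∑-cong (λ y → cong ι (∧-zeroʳ (restrict i b S y)))) (∑-const n (+ 0))
    select : ∀ a → ∑ (λ y → ι (restrict i false S y ∧ does (false ≟B a))) +
                   ∑ (λ y → ι (restrict i true S y ∧ does (true ≟B a))) ≡ ∑ (ι ∘ restrict i a S)
    select false = trans (cong₂ _+_ (keep false) (drop true)) (+-identityʳ _)
    select true = trans (cong₂ _+_ (drop false) (keep true)) (+-identityˡ _)

  vol-2^ : ∀ n → vol n ≡ + (2 ℕ.^ n)
  vol-2^ zero = refl
  vol-2^ (suc n) = trans (cong (_*_ (+ 2)) (vol-2^ n)) (sym (pos-* 2 (2 ℕ.^ n)))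

  min-of-pairs : (g h : A → ℕ) (c : ℕ) (xs : List A) {x : A} → x ∈ xs →
    let m = foldr ℕ._⊓_ c (concatMap (λ i → g i ∷ h i ∷ []) xs) in m ℕ.≤ g x × m ℕ.≤ h x
  min-of-pairs g h c (x ∷ xs) (here refl) =
    ℕ.m⊓n≤m (g x) _ , ℕ.≤-trans (ℕ.m⊓n≤n (g x) _) (ℕ.m⊓n≤m (h x) _)
  min-of-pairs g h c (y ∷ xs) (there x∈xs) with min-of-pairs g h c xs x∈xs
  ... | l , r = ℕ.≤-trans below l , ℕ.≤-trans below r
    where
    below = ℕ.≤-trans (ℕ.m⊓n≤n (g y) _) (ℕ.m⊓n≤n (h y) _)

  Type≤halfPlaneCount : (S : Subset n) (i : Fin n) (a : Bool) → Type S ℕ.≤ halfPlaneCount S i a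
  Type≤halfPlaneCount {n} S i a = pick a
    where
    both = min-of-pairs (λ i → halfPlaneCount S i false) (λ i → halfPlaneCount S i true) (card S)
             (allFin n) (∈-allFin i)
    pick : ∀ a → Type S ℕ.≤ halfPlaneCount S i a
    pick false = proj₁ both
    pick true = proj₂ both

  -- Large and small biases

  -- The sign of the bias tells which half is sparser; that half takes the role of `p` in
  -- `large-bias-combine`.
  large-bias-bound : (S : Subset (suc n)) (i : Fin (suc n)) →
    (∀ a → + 58 * vol n ≤ + 192 * ∑ (ι ∘ restrict i a S)) → ∑ (ι ∘ S) ≤ vol n →
    (vol (suc n) < + 6 * bias i (ι ∘ S)) ⊎ (+ 6 * bias i (ι ∘ S) < - vol (suc n)) →
    + 3 * vol (suc n) ≤ + 4 * energy (ι ∘ S)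
  large-bias-bound {n} S i big small-total = finish
    where
    S₀ S₁ : Subset n
    S₀ = restrict i false S
    S₁ = restrict i true S
    δ : ℤ
    δ = ∑ (λ y → sq (ι (S₁ y) - ι (S₀ y)))
    total : ∑ (ι ∘ S₀) + ∑ (ι ∘ S₁) ≤ vol n
    total = subst (_≤ vol n) (∑-restrict i (ι ∘ S)) small-total
    six : ∀ M → + 6 * M ≡ + 3 * (+ 2 * M)
    six = solve-∀
    flip : ∀ a b → - (+ 6 * (a - b)) ≡ + 6 * (b - a)
    flip = solve-∀
    wrap : ∀ {e} → e ≡ energy (ι ∘ S) → + 6 * vol n ≤ + 4 * e → + 3 * vol (suc n) ≤ + 4 * energy (ι ∘ S)
    wrap refl = subst (_≤ + 4 * energy (ι ∘ S)) (six (vol n))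
    finish : (vol (suc n) < + 6 * bias i (ι ∘ S)) ⊎ (+ 6 * bias i (ι ∘ S) < - vol (suc n)) →
             + 3 * vol (suc n) ≤ + 4 * energy (ι ∘ S)
    finish (inj₁ h) = wrap (sym (energy-restrict i (ι ∘ S)))
      (large-bias-combine (vol n) (∑ (ι ∘ S₀)) (∑ (ι ∘ S₁)) (energy (ι ∘ S₀)) (energy (ι ∘ S₁)) δ
        (0≤vol n) (big false) total
        (subst (λ b → + 2 * vol n ≤ + 6 * b) (bias-restrict i (ι ∘ S)) (<⇒≤ h))
        (∑ι-diff S₁ S₀) (proj₁ (isoperimetry S₀)) (proj₂ (isoperimetry S₁)))
    finish (inj₂ h) = wrap
      (trans (cong (_+ δ) (+-comm (energy (ι ∘ S₁)) (energy (ι ∘ S₀)))) (sym (energy-restrict i (ι ∘ S))))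
      (large-bias-combine (vol n) (∑ (ι ∘ S₁)) (∑ (ι ∘ S₀)) (energy (ι ∘ S₁)) (energy (ι ∘ S₀)) δ
        (0≤vol n) (big true) (subst (_≤ vol n) (+-comm (∑ (ι ∘ S₀)) (∑ (ι ∘ S₁))) total)
        (subst₂ _≤_ (neg-involutive (vol (suc n)))
          (trans (cong (λ b → - (+ 6 * b)) (bias-restrict i (ι ∘ S))) (flip (∑ (ι ∘ S₁)) (∑ (ι ∘ S₀))))
          (neg-mono-≤ (<⇒≤ h)))
        (∑ι-diff′ S₁ S₀) (proj₁ (isoperimetry S₁)) (proj₂ (isoperimetry S₀)))

  boundary-bound : (S : Subset (suc n)) → ∑ (ι ∘ S) ≤ vol n →
    (∀ i a → + 58 * vol n ≤ + 192 * ∑ (ι ∘ restrict i a S)) →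
    let N = vol (suc n) ; k = ∑ (ι ∘ S) in
    + 84 * (N * N) - + 256 * ((+ 2 * k - N) * (+ 2 * k - N)) ≤ + 112 * (N * energy (ι ∘ S))
  boundary-bound {n} S small-total big
    with any? (λ i → (vol (suc n) <? + 6 * bias i (ι ∘ S)) ⊎-dec (+ 6 * bias i (ι ∘ S) <? - vol (suc n)))
  ... | yes (i , biased) =
    three-quarters-suffices (vol (suc n)) (∑ (ι ∘ S)) (energy (ι ∘ S)) (0≤vol (suc n))
      (0≤sq (+ 2 * ∑ (ι ∘ S) - vol (suc n))) (large-bias-bound S i (big i) small-total biased)
  ... | no unbiased =
    three-variance-suffices (vol (suc n)) (∑ (ι ∘ S)) (energy (ι ∘ S))
      (0≤sq (+ 2 * ∑ (ι ∘ S) - vol (suc n)))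
      (small-bias-bound S (λ i → ≮⇒≥ (λ h → unbiased (i , inj₂ h))) (λ i → ≮⇒≥ (λ h → unbiased (i , inj₁ h))))

  -- Rational form

  -- The comparison is moved to unnormalised rationals, where the order is cross multiplication and
  -- the numerators are explicit polynomials.
  clear-denominators-≤ : ∀ N .{{_ : ℕ.NonZero N}} k θ →
    + 84 * (+ N * + N) - + 256 * ((+ 2 * + k - + N) * (+ 2 * + k - + N)) ≤ + 112 * (+ N * + θ) →
    (+ N / 1) *ℚ f (+ k / N) ≤ℚ (+ θ / 1)
  clear-denominators-≤ N@(suc d) k θ h =
    toℚᵘ-cancel-≤ (ℚᵘ.≤-respˡ-≃ (ℚᵘ.≃-sym unnormalise)
      (ℚᵘ.≤-respʳ-≃ (ℚᵘ.≃-sym (toℚᵘ-fromℚᵘ (mkℚᵘ (+ θ) 0))) (*≤* cleared)))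
    where
    x y : ℚᵘ
    -- The second argument of `mkℚᵘ` is the denominator minus one: `y` is k/N - 1/2, and `fᵘ`
    -- contains 3/4 and 64/7.
    x = mkℚᵘ (+ k) d
    y = x +ᵘ mkℚᵘ -[1+ 0 ] 1
    fᵘ : ℚᵘ
    fᵘ = mkℚᵘ (+ 3) 3 +ᵘ (-ᵘ (mkℚᵘ (+ 64) 6 *ᵘ (y *ᵘ y)))

    y≃ : toℚᵘ ((+ k / N) -ℚ + 1 / 2) ≃ y
    y≃ = ℚᵘ.≃-trans (toℚᵘ-homo-+ (+ k / N) (-ℚ (+ 1 / 2))) (ℚᵘ.+-cong (toℚᵘ-fromℚᵘ x) ℚᵘ.≃-refl)

    f≃ : toℚᵘ (f (+ k / N)) ≃ fᵘ
    f≃ = ℚᵘ.≃-trans (toℚᵘ-homo-+ (+ 3 / 4) (-ℚ q)) (ℚᵘ.+-congʳ (mkℚᵘ (+ 3) 3)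
      (ℚᵘ.≃-trans (toℚᵘ-homo‿- q) (ℚᵘ.-‿cong
        (ℚᵘ.≃-trans (toℚᵘ-homo-* (+ 64 / 7) (z *ℚ z)) (ℚᵘ.*-congˡ {mkℚᵘ (+ 64) 6}
          (ℚᵘ.≃-trans (toℚᵘ-homo-* z z) (ℚᵘ.*-cong y≃ y≃)))))))
      where
      z = (+ k / N) -ℚ + 1 / 2
      q = (+ 64 / 7) *ℚ (z *ℚ z)

    unnormalise : toℚᵘ ((+ N / 1) *ℚ f (+ k / N)) ≃ mkℚᵘ (+ N) 0 *ᵘ fᵘ
    unnormalise = ℚᵘ.≃-trans (toℚᵘ-homo-* (+ N / 1) (f (+ k / N)))
      (ℚᵘ.*-cong (toℚᵘ-fromℚᵘ (mkℚᵘ (+ N) 0)) f≃)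

    -- The square of `y` has denominator `(2N)²`; the factor 7 makes it `28 N²`, and the factor 4
    -- from 3/4 makes it `112 N²`.
    den : ∀ m → + (7 ℕ.* ((m ℕ.* 2) ℕ.* (m ℕ.* 2))) ≡ + 28 * (+ m * + m)
    den m = trans (cong +_ (eq m)) (trans (pos-* 28 (m ℕ.* m)) (cong (_*_ (+ 28)) (pos-* m m)))
      where
      eq : ∀ m → 7 ℕ.* ((m ℕ.* 2) ℕ.* (m ℕ.* 2)) ≡ 28 ℕ.* (m ℕ.* m)
      eq = ℕ.solve-∀

    den′ : ∀ m → + (1 ℕ.* (4 ℕ.* (7 ℕ.* ((m ℕ.* 2) ℕ.* (m ℕ.* 2))))) ≡ + 112 * (+ m * + m)
    den′ m = trans (cong +_ (eq m)) (trans (pos-* 112 (m ℕ.* m)) (cong (_*_ (+ 112)) (pos-* m m)))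
      where
      eq : ∀ m → 1 ℕ.* (4 ℕ.* (7 ℕ.* ((m ℕ.* 2) ℕ.* (m ℕ.* 2)))) ≡ 112 ℕ.* (m ℕ.* m)
      eq = ℕ.solve-∀

    s : ℤ
    s = + k * + 2 + -[1+ 0 ] * + N

    numerator : ∀ N k → N * (+ 84 * (N * N) - + 256 * ((+ 2 * k - N) * (+ 2 * k - N))) ≡
      N * (+ 3 * (+ 28 * (N * N)) + - (+ 64 * ((k * + 2 + -[1+ 0 ] * N) * (k * + 2 + -[1+ 0 ] * N))) * + 4) * + 1
    numerator = solve-∀

    right : ∀ N θ → N * (+ 112 * (N * θ)) ≡ θ * (+ 112 * (N * N))
    right = solve-∀

    cleared : + N * (+ 3 * + (7 ℕ.* ((N ℕ.* 2) ℕ.* (N ℕ.* 2))) + - (+ 64 * (s * s)) * + 4) * + 1 ≤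
              + θ * + (1 ℕ.* (4 ℕ.* (7 ℕ.* ((N ℕ.* 2) ℕ.* (N ℕ.* 2)))))
    cleared = subst₂ _≤_
      (trans (numerator (+ N) (+ k))
        (cong (λ D → + N * (+ 3 * D + - (+ 64 * (s * s)) * + 4) * + 1) (sym (den N))))
      (trans (right (+ N) (+ θ)) (cong (_*_ (+ θ)) (sym (den′ N))))
      (*-monoˡ-≤-nonNeg (+ N) h)

  -- The closed sum 1/24 + 7/64 evaluates to 29/192, so the comparison unfolds to its
  -- cross-multiplied form.
  clear-denominators-< : ∀ N .{{_ : ℕ.NonZero N}} t →
    (+ 1 / 24) +ℚ (+ 7 / 64) <ℚ + t / N → + 29 * + N < + t * + 192
  clear-denominators-< (suc d) t h
    with ℚᵘ.<-respʳ-≃ (toℚᵘ-fromℚᵘ (mkℚᵘ (+ t) d)) (toℚᵘ-mono-< h)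
  ... | *<* r = r

  normalised-bound : ∀ n (S : Subset (suc n)) → card S ℕ.≤ 2 ℕ.^ n →
    (+ 1 / 24) +ℚ (+ 7 / 64) <ℚ scaled (suc n) (Type S) →
    (+ (2 ℕ.^ suc n) / 1) *ℚ f (scaled (suc n) (card S)) ≤ℚ (+ theta (suc n) S / 1)
  normalised-bound n S k≤half t-large =
    clear-denominators-≤ (2 ℕ.^ suc n) {{ℕ.m^n≢0 2 (suc n)}} (card S) (theta (suc n) S)
      (substitute (vol-2^ (suc n)) (sym (count-∑ S)) (sym (theta-energy S))
        (boundary-bound S small-total big))
    where
    substitute : ∀ {N N′ k k′ θ θ′} → N ≡ N′ → k ≡ k′ → θ ≡ θ′ →
      + 84 * (N * N) - + 256 * ((+ 2 * k - N) * (+ 2 * k - N)) ≤ + 112 * (N * θ) →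
      + 84 * (N′ * N′) - + 256 * ((+ 2 * k′ - N′) * (+ 2 * k′ - N′)) ≤ + 112 * (N′ * θ′)
    substitute refl refl refl h = h
    small-total : ∑ (ι ∘ S) ≤ vol n
    small-total = subst₂ _≤_ (count-∑ S) (sym (vol-2^ n)) (+≤+ k≤half)
    29N≤192T : + 29 * vol (suc n) ≤ + Type S * + 192
    29N≤192T = subst (λ N → + 29 * N ≤ + Type S * + 192) (sym (vol-2^ (suc n)))
      (<⇒≤ (clear-denominators-< (2 ℕ.^ suc n) {{ℕ.m^n≢0 2 (suc n)}} (Type S) t-large))
    -- 58 arises from 29 because the whole cube has twice the volume of a half.
    double : ∀ M → + 29 * (+ 2 * M) ≡ + 58 * M
    double = solve-∀
    big : ∀ i a → + 58 * vol n ≤ + 192 * ∑ (ι ∘ restrict i a S)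
    big i a = ≤-trans (subst₂ _≤_ (double (vol n)) (*-comm (+ Type S) (+ 192)) 29N≤192T)
      (*-monoˡ-≤-nonNeg (+ 192)
        (≤-trans (+≤+ (Type≤halfPlaneCount S i a)) (≤-reflexive (halfPlaneCount-∑ S i a))))

open import Data.Nat using (ℕ; suc; _≤_; _<_; _^_; _*_; _∸_)
open import Data.Integer using (+_)
open import Data.Rational using (_/_) renaming (_+_ to _+ℚ_; _*_ to _*ℚ_; _≤_ to _≤ℚ_; _<_ to _<ℚ_)

theorem1p3 : (n k t : ℕ) → 5 ≤ n → 0 < 2 * t → 2 * t ≤ k → k ≤ 2 ^ (n ∸ 1)
    → (+ 1 / 24) +ℚ (+ 7 / 64) <ℚ scaled n t
    → (S : Subset n) → card S ≡ k → Type S ≡ t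
    → (+ (2 ^ n) / 1) *ℚ f (scaled n k) ≤ℚ (+ theta n S / 1)
-- `5 ≤ n` excludes dimension 0; at `suc n` the bound on `k` reads `2 ^ n`, half of the vertices.
theorem1p3 (suc n) k t _ _ _ k≤half t-large S refl refl =
  Hypercube.normalised-bound n S k≤half t-large
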